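{- For every integer $r\ge 3$ and every $\varepsilon>0$, there exist a positive integer $n$ and an $n$-vertex $K_r$-free graph $G$ such that for every pair of non-adjacent vertices $u,v$, the induced subgraph $G[N(u)\cap N(v)]$ contains at least $\varepsilon n^{r-2}$ copies of $K_{r-2}$, but $G$ has no $K_r$-free homomorphic image of size smaller than $2^{\frac{1}{8r^r\varepsilon}}$ (i.e., there is no $K_r$-free graph $F$ with fewer than $2^{\frac{1}{8r^r\varepsilon}}$ vertices admitting a homomorphism $G\to F$).
   Context: A homomorphism $G\to F$ is a map $\varphi:V(G)\to V(F)$ with $\varphi(u)\varphi(v)\in E(F)$ whenever $uv\in E(G)$. -}

module Defs where

open import Level using (0ℓ)
open import Data.Empty using (⊥)
open import Data.Fin.Base using (Fin)
open import Data.Fin.Subset using (Subset; _∈_; _⊆_; _∩_; ∣_∣)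
open import Data.Integer.Base as ℤ using (+_; -[1+_])
open import Data.Nat.Base as ℕ using (ℕ; zero; suc)
import Data.Nat.Properties as ℕ
open import Data.Product.Base using (Σ; ∃; _×_; _,_; proj₁; proj₂)
open import Data.Rational.Base hiding (∣_∣)
open import Data.Rational.Properties
open import Data.Sum.Base using (_⊎_; inj₁; inj₂)
open import Data.Vec.Base using (tabulate)
open import Function.Definitions using (Injective)
open import Relation.Binary.Core using (Rel)
open import Relation.Binary.Definitions
  using (Decidable; Symmetric; Irreflexive; tri<; tri≈; tri>)
open import Relation.Binary.PropositionalEquality
  using (_≡_; _≢_; refl; sym; trans; cong; subst; subst₂)
open import Relation.Nullary using (¬_; yes; no; does; contradiction)

------------------------------------------------------------------------
-- Rational arithmetic

fromℕℚ : ℕ → ℚ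
fromℕℚ k = + k / 1

fromℕℚ-nonNeg : ∀ k → 0ℚ ≤ fromℕℚ k
fromℕℚ-nonNeg k = nonNegative⁻¹ (fromℕℚ k) {{normalize-nonNeg k 1}}

fromℕℚ-pos : ∀ k .{{_ : ℕ.NonZero k}} → 0ℚ < fromℕℚ k
fromℕℚ-pos k@(suc _) = positive⁻¹ (fromℕℚ k) {{normalize-pos k 1}}

0<1 : 0ℚ < 1ℚ
0<1 = positive⁻¹ 1ℚ

*-mono<ˡ : ∀ {c p q} → 0ℚ < c → p < q → c * p < c * q
*-mono<ˡ {c} 0<c p<q = *-monoʳ-<-pos c {{positive 0<c}} p<q

*-mono<ʳ : ∀ {c p q} → 0ℚ < c → p < q → p * c < q * c
*-mono<ʳ {c} 0<c p<q = *-monoˡ-<-pos c {{positive 0<c}} p<q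

*-mono≤ˡ : ∀ {c p q} → 0ℚ ≤ c → p ≤ q → c * p ≤ c * q
*-mono≤ˡ {c} 0≤c p≤q = *-monoˡ-≤-nonNeg c {{nonNegative 0≤c}} p≤q

*-mono≤ʳ : ∀ {c p q} → 0ℚ ≤ c → p ≤ q → p * c ≤ q * c
*-mono≤ʳ {c} 0≤c p≤q = *-monoʳ-≤-nonNeg c {{nonNegative 0≤c}} p≤q

*-cancel<ʳ : ∀ {c p q} → 0ℚ < c → p * c < q * c → p < q
*-cancel<ʳ {c} 0<c = *-cancelʳ-<-nonNeg c {{nonNegative (<⇒≤ 0<c)}}

quotient : ∀ p {c} → 0ℚ < c → ∃ λ d → d * c ≡ p
quotient p {c} 0<c = p * 1/c , trans (*-assoc p 1/c c)
  (trans (cong (p *_) (*-inverseˡ c {{>-nonZero 0<c}})) (*-identityʳ p))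
  where 1/c = (1/ c) {{>-nonZero 0<c}}

------------------------------------------------------------------------
-- Real numbers, as two-sided Dedekind cuts of the rationals

record ℝ : Set₁ where
  field
    L U         : ℚ → Set
    L-inhabited : ∃ L
    U-inhabited : ∃ U
    L-lower     : ∀ {p q} → p < q → L q → L p
    U-upper     : ∀ {p q} → p < q → U p → U q
    L-open      : ∀ {p} → L p → ∃ λ q → p < q × L q
    U-open      : ∀ {q} → U q → ∃ λ p → p < q × U p
    disjoint    : ∀ {q} → L q → U q → ⊥
    located     : ∀ {p q} → p < q → L p ⊎ U q

  L<U : ∀ {p q} → L p → U q → p < q
  L<U {p} {q} Lp Uq with <-cmp p q
  ... | tri< p<q _ _    = p<q
  ... | tri≈ _ refl _   = contradiction Uq (disjoint Lp)
  ... | tri> _ _ q<p    = contradiction Uq (disjoint (L-lower q<p Lp))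

open ℝ

infix 4 _≤ℝ_ _<ℝ_

_≤ℝ_ : Rel ℝ 0ℓ
x ≤ℝ y = ∀ {q} → L x q → L y q

_<ℝ_ : Rel ℝ 0ℓ
x <ℝ y = ∃ λ q → U x q × L y q

fromℚ : ℚ → ℝ
fromℚ x = record
  { L           = _< x
  ; U           = x <_
  ; L-inhabited = x - 1ℚ , subst (x - 1ℚ <_) (+-identityʳ x)
                             (+-monoʳ-< x (neg-antimono-< 0<1))
  ; U-inhabited = x + 1ℚ , subst (_< x + 1ℚ) (+-identityʳ x)
                             (+-monoʳ-< x 0<1)
  ; L-lower     = <-trans
  ; U-upper     = λ p<q x<p → <-trans x<p p<q
  ; L-open      = <-dense
  ; U-open      = λ x<q → let (p , x<p , p<q) = <-dense x<q in p , p<q , x<p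
  ; disjoint    = <-asym
  ; located     = loc
  }
  where
  loc : ∀ {p q} → p < q → p < x ⊎ x < q
  loc {p} {q} p<q with p <? x
  ... | yes p<x = inj₁ p<x
  ... | no  p≮x = inj₂ (≤-<-trans (≮⇒≥ p≮x) p<q)

fromℕ : ℕ → ℝ
fromℕ k = fromℚ (fromℕℚ k)

0ℝ : ℝ
0ℝ = fromℚ 0ℚ

infixl 7 _·_

_·_ : ℕ → ℝ → ℝ
k · x = record
  { L           = λ q → ∃ λ p → L x p × q < c * p
  ; U           = λ q → ∃ λ p → U x p × c * p < q
  ; L-inhabited = let (p , Lp) = L-inhabited x
                      (q , q<cp) = L-inhabited (fromℚ (c * p))
                  in q , p , Lp , q<cp
  ; U-inhabited = let (p , Up) = U-inhabited x
                      (q , cp<q) = U-inhabited (fromℚ (c * p))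
                  in q , p , Up , cp<q
  ; L-lower     = λ { r<q (p , Lp , q<cp) → p , Lp , <-trans r<q q<cp }
  ; U-upper     = λ { q<r (p , Up , cp<q) → p , Up , <-trans cp<q q<r }
  ; L-open      = λ { (p , Lp , q<cp) →
                      let (r , q<r , r<cp) = <-dense q<cp in r , q<r , p , Lp , r<cp }
  ; U-open      = λ { (p , Up , cp<q) →
                      let (r , cp<r , r<q) = <-dense cp<q in r , r<q , p , Up , cp<r }
  ; disjoint    = λ { (p , Lp , q<cp) (p′ , Up′ , cp′<q) →
                      <-irrefl refl (<-≤-trans (<-trans cp′<q q<cp)
                        (*-mono≤ˡ (fromℕℚ-nonNeg k) (<⇒≤ (L<U x Lp Up′)))) }
  ; located     = loc k
  }
  where
  c = fromℕℚ k

  loc : ∀ k {q r} → q < r →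
        (∃ λ p → L x p × q < fromℕℚ k * p) ⊎ (∃ λ p → U x p × fromℕℚ k * p < r)
  loc zero {q} {r} q<r with q <? 0ℚ
  ... | yes q<0 = let (p , Lp) = L-inhabited x
                  in inj₁ (p , Lp , subst (q <_) (sym (*-zeroˡ p)) q<0)
  ... | no  q≮0 = let (p , Up) = U-inhabited x
                  in inj₂ (p , Up , subst (_< r) (sym (*-zeroˡ p)) (≤-<-trans (≮⇒≥ q≮0) q<r))
  loc (suc k) {q} {r} q<r =
    let d = fromℕℚ (suc k)
        0<d = fromℕℚ-pos (suc k)
        (a , q<a , a<r) = <-dense q<r
        (b , a<b , b<r) = <-dense a<r
        (a′ , a′d≡a) = quotient a 0<d
        (b′ , b′d≡b) = quotient b 0<d
        a′<b′ = *-cancel<ʳ 0<d (subst₂ _<_ (sym a′d≡a) (sym b′d≡b) a<b)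
    in choose d (trans (*-comm d a′) a′d≡a) (trans (*-comm d b′) b′d≡b) q<a b<r
         (located x a′<b′)
    where
    choose : ∀ {a b a′ b′} d → d * a′ ≡ a → d * b′ ≡ b → q < a → b < r →
            L x a′ ⊎ U x b′ →
            (∃ λ p → L x p × q < d * p) ⊎ (∃ λ p → U x p × d * p < r)
    choose d refl refl q<a b<r (inj₁ La′) = inj₁ (_ , La′ , q<a)
    choose d refl refl q<a b<r (inj₂ Ub′) = inj₂ (_ , Ub′ , b<r)

L-pos : ∀ {x} → 0ℝ <ℝ x → L x 0ℚ
L-pos {x} (q , 0<q , Lq) = L-lower x 0<q Lq

·-pos : ∀ k .{{_ : ℕ.NonZero k}} {x} → 0ℝ <ℝ x → 0ℝ <ℝ k · x
·-pos k (q , 0<q , Lq) =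
  let 0<kq = subst (_< fromℕℚ k * q) (*-zeroʳ (fromℕℚ k)) (*-mono<ˡ (fromℕℚ-pos k) 0<q)
      (m , 0<m , m<kq) = <-dense 0<kq
  in m , 0<m , q , Lq , m<kq

recip : (x : ℝ) → 0ℝ <ℝ x → ℝ
recip x 0<x@(p₀ , 0<p₀ , Lp₀) = record
  { L           = λ q → ∃ λ p → U x p × q * p < 1ℚ
  ; U           = λ q → ∃ λ p → 0ℚ < p × L x p × 1ℚ < q * p
  ; L-inhabited = let (p , Up) = U-inhabited x
                  in 0ℚ , p , Up , subst (_< 1ℚ) (sym (*-zeroˡ p)) 0<1
  ; U-inhabited = let (q , qp₀≡2) = quotient (fromℕℚ 2) 0<p₀
                  in q , p₀ , 0<p₀ , Lp₀ , subst (1ℚ <_) (sym qp₀≡2) 1<2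
  ; L-lower     = λ { r<q (p , Up , qp<1) →
                      p , Up , <-trans (*-mono<ʳ (U-pos Up) r<q) qp<1 }
  ; U-upper     = λ { q<r (p , 0<p , Lp , 1<qp) →
                      p , 0<p , Lp , <-trans 1<qp (*-mono<ʳ 0<p q<r) }
  ; L-open      = λ { {q} (p , Up , qp<1) →
                      let (m , qp<m , m<1) = <-dense qp<1
                          (r , rp≡m) = quotient m (U-pos Up)
                      in r , *-cancel<ʳ (U-pos Up) (subst (q * p <_) (sym rp≡m) qp<m)
                           , p , Up , subst (_< 1ℚ) (sym rp≡m) m<1 }
  ; U-open      = λ { {q} (p , 0<p , Lp , 1<qp) →
                      let (m , 1<m , m<qp) = <-dense 1<qp
                          (r , rp≡m) = quotient m 0<p
                      in r , *-cancel<ʳ 0<p (subst (_< q * p) (sym rp≡m) m<qp)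
                           , p , 0<p , Lp , subst (1ℚ <_) (sym rp≡m) 1<m }
  ; disjoint    = λ {q} → dis {q}
  ; located     = loc
  }
  where
  1<2 : 1ℚ < fromℕℚ 2
  1<2 = *<* (ℤ.+<+ (ℕ.s≤s (ℕ.s≤s ℕ.z≤n)))

  U-pos : ∀ {p} → U x p → 0ℚ < p
  U-pos = L<U x (L-pos {x} 0<x)

  dis : ∀ {q} → (∃ λ p → U x p × q * p < 1ℚ) → (∃ λ p → 0ℚ < p × L x p × 1ℚ < q * p) → ⊥
  dis {q} (p , Up , qp<1) (p′ , 0<p′ , Lp′ , 1<qp′) =
    <-asym (<-trans 1<qp′ (*-mono<ˡ 0<q (L<U x Lp′ Up))) qp<1
    where
    0<q : 0ℚ < q
    0<q = *-cancel<ʳ 0<p′ (subst (_< q * p′) (sym (*-zeroˡ p′)) (<-trans 0<1 1<qp′))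

  loc : ∀ {q r} → q < r →
        (∃ λ p → U x p × q * p < 1ℚ) ⊎ (∃ λ p → 0ℚ < p × L x p × 1ℚ < r * p)
  loc {q} {r} q<r with 0ℚ <? q
  ... | no  0≮q =
    let (p , Up) = U-inhabited x
        qp≤0 = subst (q * p ≤_) (*-zeroˡ p) (*-mono≤ʳ (<⇒≤ (U-pos Up)) (≮⇒≥ 0≮q))
    in inj₁ (p , Up , ≤-<-trans qp≤0 0<1)
  ... | yes 0<q = choose (located x a<b)
    where
    0<r  = <-trans 0<q q<r
    r⁻¹  = proj₁ (quotient 1ℚ 0<r)
    q⁻¹  = proj₁ (quotient 1ℚ 0<q)
    r⁻¹r = proj₂ (quotient 1ℚ 0<r)
    q⁻¹q = proj₂ (quotient 1ℚ 0<q)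

    0<r⁻¹ : 0ℚ < r⁻¹
    0<r⁻¹ = *-cancel<ʳ 0<r (subst₂ _<_ (sym (*-zeroˡ r)) (sym r⁻¹r) 0<1)

    r⁻¹<q⁻¹ : r⁻¹ < q⁻¹
    r⁻¹<q⁻¹ = *-cancel<ʳ 0<q (subst (r⁻¹ * q <_) (trans r⁻¹r (sym q⁻¹q)) (*-mono<ˡ 0<r⁻¹ q<r))

    a = proj₁ (<-dense r⁻¹<q⁻¹)
    r⁻¹<a = proj₁ (proj₂ (<-dense r⁻¹<q⁻¹))
    a<q⁻¹ = proj₂ (proj₂ (<-dense r⁻¹<q⁻¹))
    b = proj₁ (<-dense a<q⁻¹)
    a<b = proj₁ (proj₂ (<-dense a<q⁻¹))
    b<q⁻¹ = proj₂ (proj₂ (<-dense a<q⁻¹))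

    choose : L x a ⊎ U x b →
             (∃ λ p → U x p × q * p < 1ℚ) ⊎ (∃ λ p → 0ℚ < p × L x p × 1ℚ < r * p)
    choose (inj₁ La) = inj₂ (a , <-trans 0<r⁻¹ r⁻¹<a , La ,
      subst₂ _<_ r⁻¹r (*-comm a r) (*-mono<ʳ 0<r r⁻¹<a))
    choose (inj₂ Ub) = inj₁ (b , Ub ,
      subst₂ _<_ (*-comm b q) q⁻¹q (*-mono<ʳ 0<q b<q⁻¹))

-- m < 2^p for rational p = a/b means m^b < 2^a (for a < 0, multiply by 2^(- a)).
infix 4 _<2^ℚ_ _<2^_

_<2^ℚ_ : ℕ → ℚ → Set
m <2^ℚ mkℚ (+ a)    b-1 _ = m ℕ.^ suc b-1 ℕ.< 2 ℕ.^ a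
m <2^ℚ mkℚ -[1+ a ] b-1 _ = m ℕ.^ suc b-1 ℕ.* 2 ℕ.^ suc a ℕ.< 1

-- m < 2^x for real x, where 2^x is the supremum of 2^p over rationals p < x.
_<2^_ : ℕ → ℝ → Set
m <2^ x = ∃ λ p → L x p × m <2^ℚ p

------------------------------------------------------------------------
-- Finite simple graphs

record Graph (n : ℕ) : Set₁ where
  field
    Adj        : Rel (Fin n) 0ℓ
    adj?       : Decidable Adj
    Adj-sym    : Symmetric Adj
    Adj-irrefl : Irreflexive _≡_ Adj

open Graph using (Adj; adj?)

module _ {n : ℕ} (G : Graph n) where

  N : Fin n → Subset n
  N u = tabulate λ v → does (adj? G u v)

  IsClique : ℕ → Subset n → Set
  IsClique s S = ∣ S ∣ ≡ s × (∀ {u v} → u ∈ S → v ∈ S → u ≢ v → Adj G u v)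

  CliqueFree : ℕ → Set
  CliqueFree s = ∀ S → ¬ IsClique s S

  -- A copy of K_s in G[W] is identified with its vertex set.
  IsCopyIn : Subset n → ℕ → Subset n → Set
  IsCopyIn W s S = S ⊆ W × IsClique s S

  ContainsAtLeast : ℝ → ℕ → Subset n → Set
  ContainsAtLeast x s W =
    ∃ λ c → x ≤ℝ fromℕ c ×
    Σ (Fin c → Subset n) λ copy → Injective _≡_ _≡_ copy × (∀ i → IsCopyIn W s (copy i))

IsHomomorphism : ∀ {n m} → Graph n → Graph m → (Fin n → Fin m) → Set
IsHomomorphism G F φ = ∀ {u v} → Adj G u v → Adj F (φ u) (φ v)

8rʳ-nonZero : ∀ {r} → 3 ℕ.≤ r → ℕ.NonZero (8 ℕ.* r ℕ.^ r)
8rʳ-nonZero {r} (ℕ.s≤s _) = ℕ.m*n≢0 8 (r ℕ.^ r) {{_}} {{ℕ.m^n≢0 r r}}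

-- 1/(8 rʳ ε); the hypotheses only ensure that the denominator is positive.
exponent : (r : ℕ) → 3 ℕ.≤ r → (ε : ℝ) → 0ℝ <ℝ ε → ℝ
exponent r 3≤r ε 0<ε =
  recip ((8 ℕ.* r ℕ.^ r) · ε) (·-pos (8 ℕ.* r ℕ.^ r) {{8rʳ-nonZero 3≤r}} {ε} 0<ε)

{-# OPTIONS --safe #-}
module Submission where

-- Let Q be the triangle-free graph whose vertices are the points x of the cube {0,1}^d and the
-- literals (i , b), with x adjacent to its antipode and to the literals it satisfies, and (i , 0)
-- adjacent to (i , 1).  Blow Q up so that points and literals have equal total weight: any two
-- non-adjacent vertices then have at least a 1/(8d) fraction of common neighbours.  Joining with
-- r - 3 independent sets of the same size gives G, with a density of at least 1/(8d (r-2)^(r-2))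
-- of common copies of K_{r-2}.  In a K_r-free image of G, non-adjacent vertices stay non-adjacent,
-- because their common K_{r-2} survives; so vertices with distinct neighbourhoods, in particular
-- the 2^d points, have distinct images.  It remains to choose d between 1/(8 r^r ε) and
-- 1/(8 (r-2)^(r-2) ε); if this leaves no d ≥ 1, then the bound is at most 2 and the complete graph
-- on r - 1 vertices will do.

open import Data.Bool.Base using (Bool; true; false)
import Data.Bool.Properties as Bool
open import Data.Empty using (⊥)
open import Data.Fin.Base as Fin using (Fin; zero; suc)
open import Data.Fin.Properties as Fin using (pigeonhole; any?; *↔×; 2↔Bool; suc-injective)
open import Data.Fin.Subset as Subset
  using (Subset; ⁅_⁆; _∪_; _∩_; ∣_∣; inside; outside; _∈_; _∉_; _⊆_)
open import Data.Fin.Subset.Properties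
  using (∪-identityˡ; x∈⁅x⁆; x∈⁅y⁆⇒x≡y; x∈p∪q⁻; x∈p∪q⁺; x∈p∩q⁺; ∉⊥; ∣⊥∣≡0)
open import Data.Integer.Base as ℤ using (+_; -[1+_])
import Data.Integer.Properties as ℤ
open import Data.Nat.Base
  using (ℕ; zero; suc; _+_; _*_; _∸_; _^_; _≤_; _<_; NonZero; z≤n; s≤s)
open import Data.Nat.Coprimality using (1-coprimeTo) renaming (sym to coprime-sym)
open import Data.Nat.Properties hiding (suc-injective)
open import Data.Nat.Solver using (module +-*-Solver)
open import Data.Product.Base using (Σ; ∃; _×_; _,_; proj₁; proj₂)
open import Data.Product.Function.NonDependent.Propositional using (_×-↔_)
open import Data.Product.Properties using (,-injectiveʳ)
open import Data.Rational.Base as ℚ using (ℚ; mkℚ; 0ℚ; 1ℚ; *<*; *≤*)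
import Data.Rational.Properties as ℚ
open import Data.Sum.Base using (_⊎_; inj₁; inj₂)
open import Data.Vec.Base using (Vec; []; _∷_; lookup; _[_]≔_; replicate; here; there)
open import Data.Vec.Properties
  using (lookup∘tabulate; lookup⇒[]=; tabulate∘lookup; tabulate-cong; lookup∘update; lookup∘update′)
open import Function.Base using (_∘_)
open import Function.Bundles using (_↔_; Inverse; Injection; mk↔ₛ′)
open import Function.Definitions using (Injective)
open import Function.Properties.Inverse using (↔-refl; ↔-sym; ↔-trans; ↔⇒↣)
open import Relation.Binary.Definitions using (Decidable; Symmetric)
open import Relation.Binary.PropositionalEquality
  using (_≡_; _≢_; refl; sym; trans; cong; cong₂; subst; subst₂; ≢-sym)
open import Relation.Nullary using (¬_; Dec; yes; no; contradiction; ¬?; decidable-stable)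
open import Relation.Nullary.Decidable using (dec-true; map′; _×-dec_)
open import Defs
open ℝ
open Graph using (Adj; adj?; Adj-sym; Adj-irrefl)
open +-*-Solver using (solve; _:*_; _:=_; con)

-- Unit fractions and the choice of the dimension

fromℕℚ-mkℚ : ∀ k → fromℕℚ k ≡ mkℚ (+ k) 0 (coprime-sym (1-coprimeTo k))
fromℕℚ-mkℚ k = ℚ.normalize-coprime (coprime-sym (1-coprimeTo k))

fromℕℚ-* : ∀ a b → fromℕℚ (a * b) ≡ fromℕℚ a ℚ.* fromℕℚ b
fromℕℚ-* a b = trans (cong (λ i → i ℚ./ 1) (ℤ.pos-* a b))
  (sym (cong₂ ℚ._*_ (fromℕℚ-mkℚ a) (fromℕℚ-mkℚ b)))

unit : ∀ k .{{_ : NonZero k}} → ℚ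
unit (suc k) = mkℚ (+ 1) k (1-coprimeTo (suc k))

unit-pos : ∀ k .{{_ : NonZero k}} → 0ℚ ℚ.< unit k
unit-pos (suc k) = ℚ.positive⁻¹ (unit (suc k))

unit-inverseˡ : ∀ k .{{_ : NonZero k}} → unit k ℚ.* fromℕℚ k ≡ 1ℚ
unit-inverseˡ (suc k) =
  trans (cong (unit (suc k) ℚ.*_) (fromℕℚ-mkℚ (suc k))) (ℚ.*-inverseʳ (unit (suc k)))

unit-anti : ∀ j k .{{_ : NonZero j}} .{{_ : NonZero k}} → j < k → unit k ℚ.< unit j
unit-anti (suc j) (suc k) j<k =
  *<* (subst₂ ℤ._<_ (sym (ℤ.*-identityˡ _)) (sym (ℤ.*-identityˡ _)) (ℤ.+<+ j<k))

-- A positive fraction has numerator at least one, so the reciprocal of its denominator is a lower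
-- bound.
archimedean : ∀ {p} → 0ℚ ℚ.< p → ∃ λ k → Σ (NonZero k) λ k≢0 → unit k {{k≢0}} ℚ.≤ p
archimedean {mkℚ (+ zero)  b-1 _} 0<p = contradiction (ℚ.drop-*<* 0<p) (ℤ.<-irrefl refl)
archimedean {mkℚ (+ suc a) b-1 _} 0<p = suc b-1 , _ ,
  *≤* (ℤ.*-monoʳ-≤-nonNeg (+ suc b-1) (ℤ.+≤+ (s≤s (z≤n {a}))))
archimedean {mkℚ -[1+ a ]  b-1 _} 0<p with () ← ℚ.drop-*<* 0<p

-- The argument `d` stands for the dimension `suc d`, which keeps the dimension positive during the
-- search.
unit-multiple : ∀ d k .{{_ : NonZero k}} → ℚ
unit-multiple d k = unit (suc d * k) {{m*n≢0 (suc d) k}}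

module _ {ε : ℝ} (0<ε : 0ℝ <ℝ ε) where

  -- Walk up d; positivity of ε stops the search.
  threshold : ∀ C B .{{_ : NonZero C}} .{{_ : NonZero B}} → 2 * C < B →
    L ε (unit-multiple 0 B) ⊎ ∃ λ d → U ε (unit-multiple d C) × L ε (unit-multiple d B)
  threshold C B 2C<B with located ε (unit-anti (1 * C) (1 * B)
                           {{m*n≢0 1 C}} {{m*n≢0 1 B}} (*-monoʳ-< 1 (≤-<-trans (m≤n*m C 2) 2C<B)))
  ... | inj₁ below = inj₁ below
  ... | inj₂ above =
    let (p , 0<p , Lp) = 0<ε
        (k , k≢0 , 1/k≤p) = archimedean 0<p
        1/[1+k]C<1/k = unit-anti k (suc k * C) {{k≢0}} {{m*n≢0 (suc k) C}} (m≤m*n (suc k) C)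
    in inj₂ (search k 0 above (L-lower ε (ℚ.<-≤-trans 1/[1+k]C<1/k 1/k≤p) Lp))
    where
    -- Locatedness only decides between two separated rationals. Since d + 2 ≤ 2(d + 1) and 2C < B,
    -- the test points satisfy 1/((d+1)B) < 1/((d+2)C): either the current `d` works, or the upper
    -- bound passes on to the next one.
    step : ∀ d → suc (suc d) * C < suc d * B
    step d = begin-strict
      suc (suc d) * C       ≤⟨ *-monoˡ-≤ C (s≤s (s≤s (m≤m*n d 2))) ⟩
      suc d * 2 * C         ≡⟨ *-assoc (suc d) 2 C ⟩
      suc d * (2 * C)       <⟨ *-monoʳ-< (suc d) 2C<B ⟩
      suc d * B             ∎
      where open ≤-Reasoning

    search : ∀ j d → U ε (unit-multiple d C) → L ε (unit-multiple (d + j) C) →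
             ∃ λ d → U ε (unit-multiple d C) × L ε (unit-multiple d B)
    search zero d above below =
      contradiction above (disjoint ε (subst (λ e → L ε (unit-multiple e C)) (+-identityʳ d) below))
    search (suc j) d above below
      with located ε (unit-anti (suc (suc d) * C) (suc d * B)
             {{m*n≢0 (suc (suc d)) C}} {{m*n≢0 (suc d) B}} (step d))
    ... | inj₁ below′ = d , above , below′
    ... | inj₂ above′ =
      search j (suc d) above′ (subst (λ e → L ε (unit-multiple e C)) (+-suc d j) below)

-- A rational below `n · ε` is less than c D p for some p below ε, and p < 1/D. Together with
-- `^-count` this gives the density of copies.
below⇒·≤ : ∀ {ε} n c D .{{_ : NonZero D}} → n ≡ c * D → U ε (unit D) → (n · ε) ≤ℝ fromℕ c
below⇒·≤ {ε} n c D refl ε<1/D {q} (p , Lp , q<np) = ℚ.<-≤-trans q<np (begin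
  fromℕℚ (c * D) ℚ.* p                     ≤⟨ *-mono≤ˡ (fromℕℚ-nonNeg (c * D)) (ℚ.<⇒≤ (L<U ε Lp ε<1/D)) ⟩
  fromℕℚ (c * D) ℚ.* unit D                ≡⟨ cong (ℚ._* unit D) (fromℕℚ-* c D) ⟩
  fromℕℚ c ℚ.* fromℕℚ D ℚ.* unit D         ≡⟨ ℚ.*-assoc (fromℕℚ c) (fromℕℚ D) (unit D) ⟩
  fromℕℚ c ℚ.* (fromℕℚ D ℚ.* unit D)       ≡⟨ cong (fromℕℚ c ℚ.*_) (ℚ.*-comm (fromℕℚ D) (unit D)) ⟩
  fromℕℚ c ℚ.* (unit D ℚ.* fromℕℚ D)       ≡⟨ cong (fromℕℚ c ℚ.*_) (unit-inverseˡ D) ⟩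
  fromℕℚ c ℚ.* 1ℚ                          ≡⟨ ℚ.*-identityʳ (fromℕℚ c) ⟩
  fromℕℚ c                                 ∎)
  where open ℚ.≤-Reasoning

-- From the real exponent to a power of two

^-cancelʳ-< : ∀ m n o → m ^ o < n ^ o → m < n
^-cancelʳ-< m n o m^o<n^o = ≰⇒> λ n≤m → <⇒≱ m^o<n^o (^-monoˡ-≤ o n≤m)

-- Write p = a/b. Then a < d b, so m^b < 2^a ≤ (2^d)^b, and the b-th powers cancel.
<2^ℚ⇒<2^ : ∀ {m} d p → p ℚ.< fromℕℚ d → m <2^ℚ p → m < 2 ^ d
<2^ℚ⇒<2^ {m} d (mkℚ (+ a) b-1 _) p<d m^b<2^a = ^-cancelʳ-< m (2 ^ d) b (begin-strict
  m ^ b           <⟨ m^b<2^a ⟩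
  2 ^ a           ≤⟨ ^-monoʳ-≤ 2 (<⇒≤ a<db) ⟩
  2 ^ (d * b)     ≡⟨ ^-*-assoc 2 d b ⟨
  (2 ^ d) ^ b     ∎)
  where
  open ≤-Reasoning
  b = suc b-1
  a<db : a < d * b
  a<db = ℤ.drop‿+<+ (subst₂ ℤ._<_ (ℤ.*-identityʳ (+ a)) (sym (ℤ.pos-* d b))
    (ℚ.drop-*<* (subst (_ ℚ.<_) (fromℕℚ-mkℚ d) p<d)))
-- A negative exponent leaves only m = 0, since the product in the hypothesis is otherwise at least
-- 1.
<2^ℚ⇒<2^ {zero}  d (mkℚ -[1+ a ] b-1 _) _ _ = m^n>0 2 d
<2^ℚ⇒<2^ {suc m} d (mkℚ -[1+ a ] b-1 _) _ m^b2^a<1 =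
  contradiction m^b2^a<1 (≤⇒≯ (*-mono-≤ (m^n>0 (suc m) (suc b-1)) (m^n>0 2 (suc a))))

-- Since 1/(dB) < ε, the exponent is below `d`. In terms of cuts, `p′` bounds `B · ε` from above
-- with p p′ < 1, while 1/(dB) < s and B s < p′ give 1 ≤ d p′; cancelling p′ leaves p < d.
<2^recip⇒<2^ : ∀ {m B d ε} .{{_ : NonZero (d * B)}} (0<Bε : 0ℝ <ℝ B · ε) →
               L ε (unit (d * B)) → m <2^ recip (B · ε) 0<Bε → m < 2 ^ d
<2^recip⇒<2^ {B = B} {d} {ε} 0<Bε 1/dB<ε (p , (p′ , (s , Us , Bs<p′) , pp′<1) , m<2^p) =
  <2^ℚ⇒<2^ d p (*-cancel<ʳ 0<p′ (ℚ.<-≤-trans pp′<1 (begin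
    1ℚ                                       ≡⟨ unit-inverseˡ (d * B) ⟨
    u ℚ.* fromℕℚ (d * B)                     ≡⟨ ℚ.*-comm u _ ⟩
    fromℕℚ (d * B) ℚ.* u                     ≤⟨ *-mono≤ˡ (fromℕℚ-nonNeg (d * B)) (ℚ.<⇒≤ (L<U ε 1/dB<ε Us)) ⟩
    fromℕℚ (d * B) ℚ.* s                     ≡⟨ cong (ℚ._* s) (fromℕℚ-* d B) ⟩
    fromℕℚ d ℚ.* fromℕℚ B ℚ.* s              ≡⟨ ℚ.*-assoc (fromℕℚ d) (fromℕℚ B) s ⟩
    fromℕℚ d ℚ.* (fromℕℚ B ℚ.* s)            ≤⟨ *-mono≤ˡ (fromℕℚ-nonNeg d) (ℚ.<⇒≤ Bs<p′) ⟩
    fromℕℚ d ℚ.* p′                          ∎))) m<2^p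
  where
  open ℚ.≤-Reasoning
  u = unit (d * B)
  0<p′ : 0ℚ ℚ.< p′
  0<p′ = ℚ.≤-<-trans (subst (ℚ._≤ fromℕℚ B ℚ.* s) (ℚ.*-zeroʳ (fromℕℚ B))
    (*-mono≤ˡ (fromℕℚ-nonNeg B) (ℚ.<⇒≤ (ℚ.<-trans (unit-pos (d * B)) (L<U ε 1/dB<ε Us))))) Bs<p′


-- Cliques as families of vertices

∣⁅x⁆∪p∣ : ∀ {n} {x : Fin n} {p} → x ∉ p → ∣ ⁅ x ⁆ ∪ p ∣ ≡ suc ∣ p ∣
∣⁅x⁆∪p∣ {x = zero}  {inside  ∷ p} x∉p = contradiction here x∉p
∣⁅x⁆∪p∣ {x = zero}  {outside ∷ p} x∉p = cong (suc ∘ ∣_∣) (∪-identityˡ p)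
∣⁅x⁆∪p∣ {x = suc x} {inside  ∷ p} x∉p = cong suc (∣⁅x⁆∪p∣ (x∉p ∘ there))
∣⁅x⁆∪p∣ {x = suc x} {outside ∷ p} x∉p = ∣⁅x⁆∪p∣ (x∉p ∘ there)

image : ∀ {s n} → (Fin s → Fin n) → Subset n
image {zero}  h = Subset.⊥
image {suc s} h = ⁅ h zero ⁆ ∪ image (h ∘ suc)

∈-image⁺ : ∀ {s n} (h : Fin s → Fin n) i → h i ∈ image h
∈-image⁺ h zero    = x∈p∪q⁺ (inj₁ (x∈⁅x⁆ (h zero)))
∈-image⁺ h (suc i) = x∈p∪q⁺ (inj₂ (∈-image⁺ (h ∘ suc) i))

∈-image⁻ : ∀ {s n} (h : Fin s → Fin n) {v} → v ∈ image h → ∃ λ i → v ≡ h i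
∈-image⁻ {zero}  h v∈ = contradiction v∈ ∉⊥
∈-image⁻ {suc s} h v∈ with x∈p∪q⁻ ⁅ h zero ⁆ (image (h ∘ suc)) v∈
... | inj₁ v∈₀ = zero , x∈⁅y⁆⇒x≡y (h zero) v∈₀
... | inj₂ v∈₊ = let (i , v≡) = ∈-image⁻ (h ∘ suc) v∈₊ in suc i , v≡

∣image∣ : ∀ {s n} (h : Fin s → Fin n) → Injective _≡_ _≡_ h → ∣ image h ∣ ≡ s
∣image∣ {zero}  {n} h inj = ∣⊥∣≡0 n
∣image∣ {suc s} h inj = trans (∣⁅x⁆∪p∣ fresh) (cong suc (∣image∣ (h ∘ suc) (suc-injective ∘ inj)))
  where
  fresh : h zero ∉ image (h ∘ suc)
  fresh h₀∈ with i , h₀≡ ← ∈-image⁻ (h ∘ suc) h₀∈ with () ← inj h₀≡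

enumerate : ∀ {n} (p : Subset n) →
            ∃ λ (e : Fin ∣ p ∣ → Fin n) → Injective _≡_ _≡_ e × (∀ i → e i ∈ p)
enumerate []            = (λ ()) , (λ { {()} }) , λ ()
enumerate (outside ∷ p) =
  let (e , inj , e∈) = enumerate p in suc ∘ e , inj ∘ suc-injective , there ∘ e∈
enumerate (inside ∷ p)  = e₊ , inj₊ , e₊∈
  where
  e    = proj₁ (enumerate p)
  inj  = proj₁ (proj₂ (enumerate p))
  e∈   = proj₂ (proj₂ (enumerate p))

  e₊ : Fin (suc ∣ p ∣) → Fin _
  e₊ zero    = zero
  e₊ (suc i) = suc (e i)

  inj₊ : Injective _≡_ _≡_ e₊
  inj₊ {zero}  {zero}  _  = refl
  inj₊ {suc i} {suc j} eq = cong suc (inj (suc-injective eq))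

  e₊∈ : ∀ i → e₊ i ∈ inside ∷ p
  e₊∈ zero    = here
  e₊∈ (suc i) = there (e∈ i)

-- Distinctness of the members is not demanded, as irreflexivity enforces it. The relation is
-- arbitrary, so that structured vertices and elements of `Fin n` are treated alike.
PairwiseAdj : ∀ {A : Set} → (A → A → Set) → ∀ {s} → (Fin s → A) → Set
PairwiseAdj _~_ h = ∀ {i j} → i ≢ j → h i ~ h j

module _ {n} (G : Graph n) where

  PairwiseAdj⇒injective : ∀ {s} {h : Fin s → Fin n} → PairwiseAdj (Adj G) h → Injective _≡_ _≡_ h
  PairwiseAdj⇒injective clique {i} {j} hᵢ≡hⱼ =
    decidable-stable (i Fin.≟ j) λ i≢j → Adj-irrefl G hᵢ≡hⱼ (clique i≢j)

  image-isClique : ∀ {s} (h : Fin s → Fin n) → PairwiseAdj (Adj G) h → IsClique G s (image h)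
  image-isClique h clique = ∣image∣ h (PairwiseAdj⇒injective clique) , adjacent
    where
    adjacent : ∀ {u v} → u ∈ image h → v ∈ image h → u ≢ v → Adj G u v
    adjacent u∈ v∈ u≢v with _ , refl ← ∈-image⁻ h u∈ | _ , refl ← ∈-image⁻ h v∈ =
      clique (u≢v ∘ cong h)

  cliqueFree⁺ : ∀ {s} → (∀ (h : Fin s → Fin n) → ¬ PairwiseAdj (Adj G) h) → CliqueFree G s
  cliqueFree⁺ free S (refl , clique) =
    let (e , inj , e∈) = enumerate S
    in free e λ {i} {j} i≢j → clique (e∈ i) (e∈ j) (i≢j ∘ inj)

  cliqueFree⁻ : ∀ {s} → CliqueFree G s → ∀ (h : Fin s → Fin n) → ¬ PairwiseAdj (Adj G) h
  cliqueFree⁻ free h clique = free (image h) (image-isClique h clique)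

  ∈N : ∀ {u v} → Adj G u v → v ∈ N G u
  ∈N {u} {v} u~v =
    lookup⇒[]= v _ (trans (lookup∘tabulate _ v) (dec-true (adj? G u v) u~v))

  -- position makes a copy determine the index of the family it comes from.
  containsAtLeast : ∀ {x c s} {W : Subset n} → x ≤ℝ fromℕ c → (h : Fin c → Fin s → Fin n) →
    (∀ i → PairwiseAdj (Adj G) (h i)) → (∀ i p → h i p ∈ W) →
    (position : Fin n → Fin s) → (∀ i p → position (h i p) ≡ p) →
    (∀ {i j} → (∀ p → h i p ≡ h j p) → i ≡ j) →
    ContainsAtLeast G x s W
  containsAtLeast {s = s} {W} x≤c h clique h∈W position position-h recover =
    _ , x≤c , image ∘ h , image-injective , isCopy
    where
    image-injective : Injective _≡_ _≡_ (image ∘ h)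
    image-injective {i} {j} eq = recover pointwise
      where
      pointwise : ∀ p → h i p ≡ h j p
      pointwise p with q , eq′ ← ∈-image⁻ (h j) (subst (h i p ∈_) eq (∈-image⁺ (h i) p)) =
        trans eq′ (cong (h j) (trans (sym (position-h j q))
          (trans (sym (cong position eq′)) (position-h i p))))

    isCopy : ∀ i → IsCopyIn G W s (image (h i))
    isCopy i = ⊆W , image-isClique (h i) (clique i)
      where
      ⊆W : image (h i) ⊆ W
      ⊆W v∈ with p , refl ← ∈-image⁻ (h i) v∈ = h∈W i p

-- Counting finite types, and boolean vectors

Fin-× : ∀ {A B : Set} {a b} → A ↔ Fin a → B ↔ Fin b → (A × B) ↔ Fin (a * b)
Fin-× A↔ B↔ = ↔-trans (A↔ ×-↔ B↔) (↔-sym *↔×)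

Fin-Vec : ∀ {A : Set} {a} → A ↔ Fin a → ∀ n → Vec A n ↔ Fin (a ^ n)
Fin-Vec A↔ zero    = mk↔ₛ′ (λ _ → zero) (λ _ → []) (λ { zero → refl }) (λ { [] → refl })
Fin-Vec A↔ (suc n) = ↔-trans uncons (Fin-× A↔ (Fin-Vec A↔ n))
  where
  uncons : Vec _ (suc n) ↔ (_ × Vec _ n)
  uncons = mk↔ₛ′ (λ { (x ∷ xs) → x , xs }) (λ { (x , xs) → x ∷ xs })
    (λ { (x , xs) → refl }) (λ { (x ∷ xs) → refl })

Fin-Bool : Bool ↔ Fin 2
Fin-Bool = ↔-sym 2↔Bool

^-distribʳ-* : ∀ o m n → (m * n) ^ o ≡ m ^ o * n ^ o
^-distribʳ-* zero    m n = refl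
^-distribʳ-* (suc o) m n =
  trans (cong (m * n *_) (^-distribʳ-* o m n)) ([m*n]*[o*p]≡[m*o]*[n*p] m n (m ^ o) (n ^ o))

lookup-ext : ∀ {A : Set} {n} {xs ys : Vec A n} → (∀ i → lookup xs i ≡ lookup ys i) → xs ≡ ys
lookup-ext {xs = xs} {ys} eq =
  trans (sym (tabulate∘lookup xs)) (trans (tabulate-cong eq) (tabulate∘lookup ys))

¬three-booleans : ∀ {a b c : Bool} → a ≢ b → b ≢ c → a ≢ c → ⊥
¬three-booleans {a} {b} {c} a≢b b≢c a≢c =
  a≢c (trans (Bool.¬-not a≢b) (sym (Bool.¬-not (≢-sym b≢c))))

-- Overwriting forgets only the entries at `i` and `j`, and these are known to agree.
update₂-injective : ∀ {A : Set} {n} (i j : Fin n) {a b : A} {xs ys : Vec A n} →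
  lookup xs i ≡ lookup ys i → lookup xs j ≡ lookup ys j →
  xs [ i ]≔ a [ j ]≔ b ≡ ys [ i ]≔ a [ j ]≔ b → xs ≡ ys
update₂-injective i j {a} {b} {xs} {ys} eqᵢ eqⱼ eq = lookup-ext at
  where
  unchanged : ∀ {k} → k ≢ i → k ≢ j → ∀ zs → lookup (zs [ i ]≔ a [ j ]≔ b) k ≡ lookup zs k
  unchanged k≢i k≢j zs = trans (lookup∘update′ k≢j (zs [ i ]≔ a) b) (lookup∘update′ k≢i zs a)

  at : ∀ k → lookup xs k ≡ lookup ys k
  at k with k Fin.≟ i | k Fin.≟ j
  ... | yes refl | _        = eqᵢ
  ... | no _     | yes refl = eqⱼ
  ... | no k≢i   | no k≢j   =
    trans (sym (unchanged k≢i k≢j xs)) (trans (cong (λ zs → lookup zs k) eq) (unchanged k≢i k≢j ys))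

-- The triangle-free graph of cube points and literals

module Blocks (d′ : ℕ) where

  d = suc d′

  -- cube i p q x is one of 4d copies of the vertex x of the cube {0,1}^d; lit i b p z is one
  -- of 2·2^d copies of the literal "the i-th coordinate is b".
  data Block : Set where
    cube lit : Fin d → Bool → Bool → Vec Bool d → Block

  -- This is 8d·2^d, so 2^d common neighbours form a 1/(8d) fraction.
  size = 2 * (d * (2 * (2 * 2 ^ d)))

  Fin-Block : Block ↔ Fin size
  Fin-Block = ↔-trans fields
    (Fin-× Fin-Bool (Fin-× ↔-refl (Fin-× Fin-Bool (Fin-× Fin-Bool (Fin-Vec Fin-Bool d)))))
    where
    fields : Block ↔ (Bool × Fin d × Bool × Bool × Vec Bool d)
    fields = mk↔ₛ′
      (λ { (cube i p q x) → true , i , p , q , x ; (lit i p q x) → false , i , p , q , x })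
      (λ { (true , i , p , q , x) → cube i p q x ; (false , i , p , q , x) → lit i p q x })
      (λ { (true , _) → refl ; (false , _) → refl })
      (λ { (cube _ _ _ _) → refl ; (lit _ _ _ _) → refl })

  infix 4 _~ᵇ_ _~ᵇ?_

  -- Antipodality is phrased as having no common coordinate, so that two non-adjacent points yield a
  -- coordinate where they agree. The copy indices are ignored, which makes this a blow-up.
  _~ᵇ_ : Block → Block → Set
  cube _ _ _ x ~ᵇ cube _ _ _ y = ¬ ∃ λ i → lookup x i ≡ lookup y i
  cube _ _ _ x ~ᵇ lit i b _ _  = lookup x i ≡ b
  lit i b _ _  ~ᵇ cube _ _ _ x = lookup x i ≡ b
  lit i a _ _  ~ᵇ lit j b _ _  = i ≡ j × a ≢ b

  _~ᵇ?_ : Decidable _~ᵇ_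
  cube _ _ _ x ~ᵇ? cube _ _ _ y = ¬? (any? λ i → lookup x i Bool.≟ lookup y i)
  cube _ _ _ x ~ᵇ? lit i b _ _  = lookup x i Bool.≟ b
  lit i b _ _  ~ᵇ? cube _ _ _ x = lookup x i Bool.≟ b
  lit i a _ _  ~ᵇ? lit j b _ _  = (i Fin.≟ j) ×-dec ¬? (a Bool.≟ b)

  ~ᵇ-sym : Symmetric _~ᵇ_
  ~ᵇ-sym {cube _ _ _ _} {cube _ _ _ _} x~y         = λ (i , eq) → x~y (i , sym eq)
  ~ᵇ-sym {cube _ _ _ _} {lit _ _ _ _}  x~l         = x~l
  ~ᵇ-sym {lit _ _ _ _}  {cube _ _ _ _} l~x         = l~x
  ~ᵇ-sym {lit _ _ _ _}  {lit _ _ _ _}  (i≡j , a≢b) = sym i≡j , ≢-sym a≢b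

  ~ᵇ-irrefl : ∀ {a} → ¬ a ~ᵇ a
  ~ᵇ-irrefl {cube _ _ _ _} x~x       = x~x (zero , refl)
  ~ᵇ-irrefl {lit _ _ _ _}  (_ , b≢b) = b≢b refl

  -- Adjacent points agree nowhere, so no literal holds at both; a point satisfies only one of two
  -- opposite literals. Three points, compared at coordinate `zero`, or three literals would need
  -- three distinct booleans.
  ~ᵇ-triangleFree : ∀ a b c → a ~ᵇ b → b ~ᵇ c → a ~ᵇ c → ⊥
  ~ᵇ-triangleFree (cube _ _ _ _) (cube _ _ _ _) (cube _ _ _ _) x~y y~z x~z =
    ¬three-booleans (λ eq → x~y (zero , eq)) (λ eq → y~z (zero , eq)) (λ eq → x~z (zero , eq))
  ~ᵇ-triangleFree (cube _ _ _ _) (cube _ _ _ _) (lit i _ _ _)  x~y yᵢ xᵢ = x~y (i , trans xᵢ (sym yᵢ))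
  ~ᵇ-triangleFree (cube _ _ _ _) (lit i _ _ _)  (cube _ _ _ _) xᵢ yᵢ x~y = x~y (i , trans xᵢ (sym yᵢ))
  ~ᵇ-triangleFree (lit i _ _ _)  (cube _ _ _ _) (cube _ _ _ _) xᵢ x~y yᵢ = x~y (i , trans xᵢ (sym yᵢ))
  ~ᵇ-triangleFree (cube _ _ _ _) (lit _ _ _ _)  (lit _ _ _ _)  xᵢ (refl , a≢b) xⱼ = a≢b (trans (sym xᵢ) xⱼ)
  ~ᵇ-triangleFree (lit _ _ _ _)  (cube _ _ _ _) (lit _ _ _ _)  xᵢ xⱼ (refl , a≢b) = a≢b (trans (sym xᵢ) xⱼ)
  ~ᵇ-triangleFree (lit _ _ _ _)  (lit _ _ _ _)  (cube _ _ _ _) (refl , a≢b) xⱼ xᵢ = a≢b (trans (sym xᵢ) xⱼ)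
  ~ᵇ-triangleFree (lit _ _ _ _)  (lit _ _ _ _)  (lit _ _ _ _)  (refl , a≢b) (refl , b≢c) (_ , a≢c) =
    ¬three-booleans a≢b b≢c a≢c

  -- Two non-adjacent points share a literal; a point violating a literal satisfies its negation;
  -- two literals that are not opposite hold together at some points. For literals as neighbours,
  -- `z` is the copy index and `false` an arbitrary choice of half of the copies.
  common-neighbours : ∀ a b → ¬ a ~ᵇ b →
    ∃ λ (f : Vec Bool d → Block) → Injective _≡_ _≡_ f × (∀ z → a ~ᵇ f z × b ~ᵇ f z)
  common-neighbours (cube _ _ _ x) (cube _ _ _ y) x≁y
    with i , xᵢ≡yᵢ ← decidable-stable (any? λ i → lookup x i Bool.≟ lookup y i) x≁y =
    lit i (lookup x i) false , (λ { refl → refl }) , λ _ → refl , sym xᵢ≡yᵢ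
  common-neighbours (cube _ _ _ x) (lit i b _ _) xᵢ≢b =
    lit i (lookup x i) false , (λ { refl → refl }) , λ _ → refl , refl , ≢-sym xᵢ≢b
  common-neighbours (lit i b _ _) (cube _ _ _ x) xᵢ≢b =
    lit i (lookup x i) false , (λ { refl → refl }) , λ _ → (refl , ≢-sym xᵢ≢b) , refl
  common-neighbours (lit i a _ _) (lit j b _ _) i≁j = f , f-injective , λ z → at-i z , lookup∘update j (z [ i ]≔ a) b
    where
    -- The two bits overwritten in z are kept in the copy index.
    f : Vec Bool d → Block
    f z = cube i (lookup z i) (lookup z j) (z [ i ]≔ a [ j ]≔ b)

    cube-injective : ∀ {i p q x i′ p′ q′ x′} → cube i p q x ≡ cube i′ p′ q′ x′ → p ≡ p′ × q ≡ q′ × x ≡ x′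
    cube-injective refl = refl , refl , refl

    f-injective : Injective _≡_ _≡_ f
    f-injective eq = let (eqᵢ , eqⱼ , eq′) = cube-injective eq in update₂-injective i j eqᵢ eqⱼ eq′

    -- If i = j, the second write replaces the first, but non-adjacent literals on one coordinate
    -- have the same value.
    at-i : ∀ z → lookup (z [ i ]≔ a [ j ]≔ b) i ≡ a
    at-i z with i Fin.≟ j
    ... | yes refl = trans (lookup∘update i (z [ i ]≔ a) b)
                       (sym (decidable-stable (a Bool.≟ b) λ a≢b → i≁j (refl , a≢b)))
    ... | no  i≢j  = trans (lookup∘update′ i≢j (z [ i ]≔ a) b) (lookup∘update i z a)

  -- With `edge-lit`, this codes a pair of a vector `y` and a block injectively as an edge: the
  -- fields of the block form the point, while the literal stores the constructor in its boolean
  -- copy index and `y` in its vector.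
  edge-cube : Block → Block
  edge-cube (cube i p q x) = cube i p q x
  edge-cube (lit  i p q x) = cube i p q x

  edge-lit : Vec Bool d → Block → Block
  edge-lit y (cube i p q x) = lit i (lookup x i) true y
  edge-lit y (lit  i p q x) = lit i (lookup x i) false y

  edge-adj : ∀ y a → edge-cube a ~ᵇ edge-lit y a
  edge-adj y (cube _ _ _ _) = refl
  edge-adj y (lit _ _ _ _)  = refl

  edge-injective : ∀ {y z} a b → edge-cube a ≡ edge-cube b → edge-lit y a ≡ edge-lit z b → y ≡ z × a ≡ b
  edge-injective (cube _ _ _ _) (cube _ _ _ _) refl refl = refl , refl
  edge-injective (lit _ _ _ _)  (lit _ _ _ _)  refl refl = refl , refl

  -- The join with `k` independent sets

  module _ (k : ℕ) where

    Vertex : Set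
    Vertex = Fin (suc k) × Block

    infix 4 _~_ _~?_

    -- Outside part `zero` the block is only a label, so all parts have `size` vertices.
    data _~_ : Vertex → Vertex → Set where
      base : ∀ {a b} → a ~ᵇ b → (zero , a) ~ (zero , b)
      join : ∀ {p q a b} → p ≢ q → (p , a) ~ (q , b)

    base⁻ : ∀ {a b} → (zero , a) ~ (zero , b) → a ~ᵇ b
    base⁻ (base a~b) = a~b
    base⁻ (join 0≢0) = contradiction refl 0≢0

    independent : ∀ {p a b} → ¬ (suc p , a) ~ (suc p , b)
    independent (join p≢p) = p≢p refl

    _~?_ : Decidable _~_
    (p , a) ~? (q , b) with p Fin.≟ q
    (zero  , a) ~? (_ , b) | yes refl = map′ base base⁻ (a ~ᵇ? b)
    (suc p , a) ~? (_ , b) | yes refl = no independent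
    ...                    | no p≢q   = yes (join p≢q)

    ~-sym : Symmetric _~_
    ~-sym (base a~b) = base (~ᵇ-sym a~b)
    ~-sym (join p≢q) = join (≢-sym p≢q)

    ~-irrefl : ∀ {u} → ¬ u ~ u
    ~-irrefl (base a~a) = ~ᵇ-irrefl a~a
    ~-irrefl (join p≢p) = p≢p refl

    adjacent-same-part : ∀ {u v} → u ~ v → proj₁ u ≡ proj₁ v → proj₁ u ≡ zero
    adjacent-same-part (base _)   _   = refl
    adjacent-same-part (join p≢q) p≡q = contradiction p≡q p≢q

    part-zero-triangleFree : ∀ {u v w} → proj₁ u ≡ zero → proj₁ v ≡ zero → proj₁ w ≡ zero →
                             u ~ v → v ~ w → u ~ w → ⊥
    part-zero-triangleFree refl refl refl u~v v~w u~w =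
      ~ᵇ-triangleFree _ _ _ (base⁻ u~v) (base⁻ v~w) (base⁻ u~w)

    -- Pigeonhole puts a vertex u of the clique in part 0; with u in a colour of its own, a second
    -- pigeonhole gives two more there.
    ~-cliqueFree : (h : Fin (3 + k) → Vertex) → ¬ PairwiseAdj _~_ h
    ~-cliqueFree h clique
      with u , u′ , u<u′ , eq ← pigeonhole (m≤n⇒m≤1+n (n<1+n (suc k))) (proj₁ ∘ h) =
      refute (pigeonhole (n<1+n (2 + k)) colour)
      where
      colour : Fin (3 + k) → Fin (2 + k)
      colour v with v Fin.≟ u
      ... | yes _ = zero
      ... | no  _ = suc (proj₁ (h v))

      u∈₀ : proj₁ (h u) ≡ zero
      u∈₀ = adjacent-same-part (clique (Fin.<⇒≢ u<u′)) eq

      refute : ¬ ∃ λ v → ∃ λ w → v Fin.< w × colour v ≡ colour w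
      refute (v , w , v<w , same) with v Fin.≟ u | w Fin.≟ u
      ... | yes refl | yes refl = Fin.<-irrefl refl v<w
      ... | no v≢u   | no w≢u   =
        part-zero-triangleFree u∈₀ v∈₀ (trans (sym (suc-injective same)) v∈₀)
          (clique (≢-sym v≢u)) v~w (clique (≢-sym w≢u))
        where
        v~w = clique (Fin.<⇒≢ v<w)
        v∈₀ = adjacent-same-part v~w (suc-injective same)

    -- Cliques common to two non-adjacent vertices

    Index : Set
    Index = Vec Bool d × Vec Block k

    -- `position` and `recover` ensure that different indices give different vertex sets, as the
    -- count of copies requires.
    record CommonCliques (u v : Vertex) : Set where
      field
        copy          : Index → Fin (suc k) → Vertex
        clique        : ∀ i → PairwiseAdj _~_ (copy i)
        adj           : ∀ i p → u ~ copy i p × v ~ copy i p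
        position      : Vertex → Fin (suc k)
        position-copy : ∀ i p → position (copy i p) ≡ p
        recover       : ∀ {i j} → (∀ p → copy i p ≡ copy j p) → i ≡ j

    -- Vertices of distinct parts are adjacent, so `u` and `v` share a part and are joined to all
    -- others. In part `zero`, a common neighbour there is extended by one free choice from each of
    -- the `k` other parts.
    common-cliques : ∀ u v → ¬ u ~ v → CommonCliques u v
    common-cliques (p , a) (q , b) u≁v
      with refl ← decidable-stable (p Fin.≟ q) (λ p≢q → u≁v (join p≢q)) = go p u≁v
      where
      go : ∀ p → ¬ (p , a) ~ (p , b) → CommonCliques (p , a) (p , b)
      go zero u≁v with f , f-injective , f-adj ← common-neighbours a b (u≁v ∘ base) = record
        { copy          = copy
        ; clique        = clique
        ; adj           = adj
        ; position      = proj₁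
        ; position-copy = λ { _ zero → refl ; _ (suc p) → refl }
        ; recover       = λ eq → cong₂ _,_ (f-injective (,-injectiveʳ (eq zero)))
                                           (lookup-ext λ p → ,-injectiveʳ (eq (suc p)))
        }
        where
        copy : Index → Fin (suc k) → Vertex
        copy (y , g) zero    = zero , f y
        copy (y , g) (suc p) = suc p , lookup g p

        clique : ∀ i → PairwiseAdj _~_ (copy i)
        clique i {zero}  {zero}  p≢q = contradiction refl p≢q
        clique i {zero}  {suc q} p≢q = join p≢q
        clique i {suc p} {zero}  p≢q = join p≢q
        clique i {suc p} {suc q} p≢q = join p≢q

        adj : ∀ i p → (zero , a) ~ copy i p × (zero , b) ~ copy i p
        adj (y , g) zero    = base (proj₁ (f-adj y)) , base (proj₂ (f-adj y))
        adj (y , g) (suc p) = join (λ ()) , join λ ()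
      -- A copy avoiding part q needs two vertices of part 0, i.e. an edge; the unused entry of g
      -- at q selects it.
      go (suc q) u≁v = record
        { copy          = copy
        ; clique        = clique
        ; adj           = adj
        ; position      = position
        ; position-copy = position-copy
        ; recover       = recover
        }
        where
        -- Slot `suc q`, whose own part is excluded, receives the point of the edge; slot `zero`
        -- receives the literal.
        at : Vec Block k → ∀ p → Dec (p ≡ q) → Vertex
        at g p (yes _) = zero , edge-cube (lookup g p)
        at g p (no _)  = suc p , lookup g p

        copy : Index → Fin (suc k) → Vertex
        copy (y , g) zero    = zero , edge-lit y (lookup g q)
        copy (y , g) (suc p) = at g p (p Fin.≟ q)

        clique : ∀ i → PairwiseAdj _~_ (copy i)
        clique i {zero}  {zero}  p≢r = contradiction refl p≢r
        clique (y , g) {zero}  {suc r} p≢r with r Fin.≟ q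
        ... | yes refl = base (~ᵇ-sym {edge-cube (lookup g q)} (edge-adj y (lookup g q)))
        ... | no _     = join λ ()
        clique (y , g) {suc p} {zero}  p≢r with p Fin.≟ q
        ... | yes refl = base (edge-adj y (lookup g q))
        ... | no _     = join λ ()
        clique i {suc p} {suc r} p≢r with p Fin.≟ q | r Fin.≟ q
        ... | yes refl | yes refl = contradiction refl p≢r
        ... | yes refl | no _     = join λ ()
        ... | no _     | yes refl = join λ ()
        ... | no _     | no _     = join p≢r

        adj : ∀ i p → (suc q , a) ~ copy i p × (suc q , b) ~ copy i p
        adj i zero    = join (λ ()) , join λ ()
        adj i (suc p) with p Fin.≟ q
        ... | yes _  = join (λ ()) , join λ ()
        ... | no p≢q = join (≢-sym p≢q ∘ suc-injective) , join (≢-sym p≢q ∘ suc-injective)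

        -- Slots `zero` and `suc q` both lie in part `zero`; the constructor of the block tells them
        -- apart.
        position : Vertex → Fin (suc k)
        position (zero  , cube _ _ _ _) = suc q
        position (zero  , lit _ _ _ _)  = zero
        position (suc p , _)            = suc p

        position-cube : ∀ c → position (zero , edge-cube c) ≡ suc q
        position-cube (cube _ _ _ _) = refl
        position-cube (lit _ _ _ _)  = refl

        position-lit : ∀ y c → position (zero , edge-lit y c) ≡ zero
        position-lit y (cube _ _ _ _) = refl
        position-lit y (lit _ _ _ _)  = refl

        position-copy : ∀ i p → position (copy i p) ≡ p
        position-copy (y , g) zero = position-lit y (lookup g q)
        position-copy (y , g) (suc p) with p Fin.≟ q
        ... | yes refl = position-cube (lookup g q)
        ... | no _     = refl

        recover : ∀ {i j} → (∀ p → copy i p ≡ copy j p) → i ≡ j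
        recover {y , g} {z , h} eq = cong₂ _,_ (proj₁ edge-eq) (lookup-ext entry)
          where
          -- Slot `suc q` reveals only the point; `y` and the constructor of the entry at `q` come
          -- from the literal in slot `zero`.
          cube-eq : edge-cube (lookup g q) ≡ edge-cube (lookup h q)
          cube-eq with eq (suc q)
          ... | eq-q with q Fin.≟ q
          ...   | yes _  = ,-injectiveʳ eq-q
          ...   | no q≢q = contradiction refl q≢q

          edge-eq : y ≡ z × lookup g q ≡ lookup h q
          edge-eq = edge-injective (lookup g q) (lookup h q) cube-eq (,-injectiveʳ (eq zero))

          entry : ∀ p → lookup g p ≡ lookup h p
          entry p with eq (suc p)
          ... | eq-p with p Fin.≟ q
          ...   | yes refl = proj₂ edge-eq
          ...   | no _     = ,-injectiveʳ eq-p

    -- The graph on `Fin n` and its common cliques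

    n = suc k * size

    Fin-Vertex : Vertex ↔ Fin n
    Fin-Vertex = Fin-× ↔-refl Fin-Block

    encode : Vertex → Fin n
    encode = Inverse.to Fin-Vertex

    decode : Fin n → Vertex
    decode = Inverse.from Fin-Vertex

    n>0 : 0 < n
    n>0 = ≤-<-trans z≤n (Fin.toℕ<n (encode (zero , lit zero false false (replicate d false))))

    decode-encode : ∀ u → decode (encode u) ≡ u
    decode-encode = Inverse.strictlyInverseʳ Fin-Vertex

    G : Graph n
    G = record
      { Adj        = λ u v → decode u ~ decode v
      ; adj?       = λ u v → decode u ~? decode v
      ; Adj-sym    = ~-sym
      ; Adj-irrefl = λ { refl → ~-irrefl }
      }

    encode-adj : ∀ {u v} → u ~ v → Adj G (encode u) (encode v)
    encode-adj {u} {v} = subst₂ _~_ (sym (decode-encode u)) (sym (decode-encode v))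

    G-cliqueFree : CliqueFree G (3 + k)
    G-cliqueFree = cliqueFree⁺ G λ h → ~-cliqueFree (decode ∘ h)

    copies = 2 ^ d * size ^ k

    Fin-Index : Index ↔ Fin copies
    Fin-Index = Fin-× (Fin-Vec Fin-Bool d) (Fin-Vec Fin-Block k)

    G-contains : ∀ {x} → x ≤ℝ fromℕ copies → ∀ u v → ¬ Adj G u v →
                 ContainsAtLeast G x (suc k) (N G u ∩ N G v)
    G-contains {x} x≤copies u v u≁v = containsAtLeast G {x} x≤copies
      (λ c p → encode (copy (index c) p))
      (λ c p≢q → encode-adj (clique (index c) p≢q))
      (λ c p → x∈p∩q⁺ (∈N G (decode-adj (proj₁ (adj (index c) p))) ,
                        ∈N G (decode-adj (proj₂ (adj (index c) p)))))
      (position ∘ decode)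
      (λ c p → trans (cong position (decode-encode _)) (position-copy (index c) p))
      (λ eq → from-injective (recover λ p → to-injective (eq p)))
      where
      open CommonCliques (common-cliques (decode u) (decode v) u≁v)
      index = Inverse.from Fin-Index

      decode-adj : ∀ {w a} → decode w ~ a → decode w ~ decode (encode a)
      decode-adj {a = a} = subst (_ ~_) (sym (decode-encode a))

      from-injective : ∀ {c c′} → index c ≡ index c′ → c ≡ c′
      from-injective = Injection.injective (↔⇒↣ (↔-sym Fin-Index))

      to-injective : ∀ {a b} → encode a ≡ encode b → a ≡ b
      to-injective = Injection.injective (↔⇒↣ Fin-Vertex)

    -- Clique-free homomorphic images

    module _ {m} (F : Graph m) (F-cliqueFree : CliqueFree F (3 + k))
             (ψ : Vertex → Fin m) (ψ-hom : ∀ {u v} → u ~ v → Adj F (ψ u) (ψ v)) where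

      -- If the images were adjacent, they would form a clique of size 3 + k in `F` with the image
      -- of a common clique of size 1 + k; any one index supplies such a clique.
      reflects-adj : ∀ {u v} → ¬ u ~ v → ¬ Adj F (ψ u) (ψ v)
      reflects-adj {u} {v} u≁v ψu~ψv = cliqueFree⁻ F F-cliqueFree h h-clique
        where
        open CommonCliques (common-cliques u v u≁v)

        index : Index
        index = replicate d false , replicate k (lit zero false false (replicate d false))

        h : Fin (3 + k) → Fin m
        h zero          = ψ u
        h (suc zero)    = ψ v
        h (suc (suc p)) = ψ (copy index p)

        h-clique : PairwiseAdj (Adj F) h
        h-clique {zero}        {zero}        p≢q = contradiction refl p≢q
        h-clique {zero}        {suc zero}    _   = ψu~ψv
        h-clique {zero}        {suc (suc q)} _   = ψ-hom (proj₁ (adj index q))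
        h-clique {suc zero}    {zero}        _   = Adj-sym F ψu~ψv
        h-clique {suc zero}    {suc zero}    p≢q = contradiction refl p≢q
        h-clique {suc zero}    {suc (suc q)} _   = ψ-hom (proj₂ (adj index q))
        h-clique {suc (suc p)} {zero}        _   = Adj-sym F (ψ-hom (proj₁ (adj index p)))
        h-clique {suc (suc p)} {suc zero}    _   = Adj-sym F (ψ-hom (proj₂ (adj index p)))
        h-clique {suc (suc p)} {suc (suc q)} p≢q =
          ψ-hom (clique index (p≢q ∘ cong λ r → Fin.suc (Fin.suc r)))

      cube-vertex : Vec Bool d → Vertex
      cube-vertex x = zero , cube zero false false x

      -- If x and y differ at i, the literal (i , xᵢ) is adjacent to x but not to y. Equal images
      -- would make its image adjacent to that of y, against `reflects-adj`.
      cubes-separated : ∀ x y → ψ (cube-vertex x) ≡ ψ (cube-vertex y) → x ≡ y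
      cubes-separated x y eq with any? (λ i → ¬? (lookup x i Bool.≟ lookup y i))
      ... | no x≗y          = lookup-ext λ i →
        decidable-stable (lookup x i Bool.≟ lookup y i) λ xᵢ≢yᵢ → x≗y (i , xᵢ≢yᵢ)
      ... | yes (i , xᵢ≢yᵢ) = contradiction
        (subst (Adj F _) eq (ψ-hom {zero , lit i (lookup x i) false x} {cube-vertex x} (base refl)))
        (reflects-adj (xᵢ≢yᵢ ∘ sym ∘ base⁻))

      2^d≤m : 2 ^ d ≤ m
      2^d≤m = Fin.injective⇒≤ {f = ψ ∘ cube-vertex ∘ Inverse.from (Fin-Vec Fin-Bool d)}
        (Injection.injective (↔⇒↣ (↔-sym (Fin-Vec Fin-Bool d))) ∘ cubes-separated _ _)

    G-homs : ∀ {m} (F : Graph m) → CliqueFree F (3 + k) →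
             (∃ λ φ → IsHomomorphism G F φ) → 2 ^ d ≤ m
    G-homs F F-cliqueFree (φ , φ-hom) =
      2^d≤m F F-cliqueFree (φ ∘ encode) λ u~v → φ-hom (encode-adj u~v)

    -- One of the k + 1 factors `size` is expanded as 8d·2^d; its 2^d and the remaining `size ^ k`
    -- make up `copies`.
    ^-count : n ^ suc k ≡ copies * (d * (8 * suc k ^ suc k))
    ^-count = trans (^-distribʳ-* (suc k) (suc k) size)
      (solve 4 (λ a e t s → a :* (con 2 :* (e :* (con 2 :* (con 2 :* t))) :* s)
                              := t :* s :* (e :* (con 8 :* a))) refl
        (suc k ^ suc k) d (2 ^ d) (size ^ k))

-- Complete graphs for large ε, and the theorem

complete : ∀ n → Graph n
complete n = record
  { Adj        = _≢_
  ; adj?       = λ u v → ¬? (u Fin.≟ v)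
  ; Adj-sym    = ≢-sym
  ; Adj-irrefl = λ u≡v u≢v → u≢v u≡v
  }

complete-cliqueFree : ∀ n → CliqueFree (complete n) (suc n)
complete-cliqueFree n = cliqueFree⁺ (complete n) λ h clique →
  let (i , j , i<j , hᵢ≡hⱼ) = pigeonhole (n<1+n n) h in clique (Fin.<⇒≢ i<j) hᵢ≡hⱼ

¬complete-hom : ∀ {n m} (F : Graph m) → m < n → ¬ ∃ λ φ → IsHomomorphism (complete n) F φ
¬complete-hom F m<n (φ , φ-hom) =
  let (i , j , i<j , φᵢ≡φⱼ) = pigeonhole m<n φ in Adj-irrefl F φᵢ≡φⱼ (φ-hom (Fin.<⇒≢ i<j))

-- With s = r - 2, raising the base gives s^s ≤ r^s, and one of the two further factors r absorbs
-- the 2 because r ≥ 3. The factor 2 is what `threshold` needs to pass from one dimension to the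
-- next.
threshold-gap : ∀ k → 2 * (8 * suc k ^ suc k) < 8 * (3 + k) ^ (3 + k)
threshold-gap k = begin-strict
  2 * (8 * s ^ s)          ≤⟨ *-monoʳ-≤ 2 (*-monoʳ-≤ 8 (^-monoˡ-≤ s (m≤n+m s 2))) ⟩
  2 * (8 * r ^ s)          ≡⟨ solve 1 (λ x → con 2 :* (con 8 :* x) := con 8 :* (con 2 :* x)) refl (r ^ s) ⟩
  8 * (2 * r ^ s)          <⟨ *-monoʳ-< 8 (*-monoˡ-< (r ^ s) {{m^n≢0 r s}} (s≤s (s≤s (s≤s (z≤n {k}))))) ⟩
  8 * r ^ suc s            ≤⟨ *-monoʳ-≤ 8 (m≤n*m (r ^ suc s) r) ⟩
  8 * r ^ r                ∎
  where
  open ≤-Reasoning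
  s = suc k
  r = 3 + k

8nⁿ-nonZero : ∀ n .{{_ : NonZero n}} → NonZero (8 * n ^ n)
8nⁿ-nonZero n = m*n≢0 8 (n ^ n) {{_}} {{m^n≢0 n n}}

construction : ∀ k {ε B} .{{_ : NonZero B}} (0<Bε : 0ℝ <ℝ B · ε) →
  L ε (unit-multiple 0 B) ⊎
  (∃ λ d → U ε (unit-multiple d (8 * suc k ^ suc k) {{8nⁿ-nonZero (suc k)}}) × L ε (unit-multiple d B)) →
  Σ ℕ λ n → 0 < n × Σ (Graph n) λ G →
    CliqueFree G (3 + k) ×
    (∀ u v → u ≢ v → ¬ Adj G u v → ContainsAtLeast G ((n ^ suc k) · ε) (suc k) (N G u ∩ N G v)) ×
    (∀ m (F : Graph m) → CliqueFree F (3 + k) → m <2^ recip (B · ε) 0<Bε →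
      ¬ (∃ λ (φ : Fin n → Fin m) → IsHomomorphism G F φ))
-- Here 1/(Bε) < 1, so `F` has fewer than 2 ≤ 2 + k vertices; the density condition is vacuous.
construction k {ε} {B} 0<Bε (inj₁ below) =
  2 + k , s≤s z≤n , complete (2 + k) , complete-cliqueFree (2 + k) ,
  (λ u v u≢v u≁v → contradiction u≢v u≁v) ,
  λ m F _ m<2^e → ¬complete-hom F (<-≤-trans
    (<2^recip⇒<2^ {B = B} {1} {ε} {{m*n≢0 1 B}} 0<Bε below m<2^e) (s≤s (s≤s z≤n)))
-- `above` yields the density of common cliques, `below` the lower bound on the size of an image.
construction k {ε} {B} 0<Bε (inj₂ (d′ , above , below)) =
  n k , n>0 k , G k , G-cliqueFree k ,
  (λ u v _ → G-contains k {n k ^ suc k · ε} (below⇒·≤ {ε} (n k ^ suc k) (copies k)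
    (d * (8 * suc k ^ suc k)) {{m*n≢0 d _ {{_}} {{8nⁿ-nonZero (suc k)}}}} (^-count k) above) u v) ,
  λ m F F-cliqueFree m<2^e hom → <⇒≱
    (<2^recip⇒<2^ {B = B} {d} {ε} {{m*n≢0 d B}} 0<Bε below m<2^e) (G-homs k F F-cliqueFree hom)
  where open Blocks d′

theorem1p7 : (r : ℕ) (3≤r : 3 ≤ r) (ε : ℝ) (0<ε : 0ℝ <ℝ ε) →
    Σ ℕ λ n → 0 < n × Σ (Graph n) λ G →
    CliqueFree G r ×
    (∀ u v → u ≢ v → ¬ Graph.Adj G u v →
    ContainsAtLeast G ((n ^ (r ∸ 2)) · ε) (r ∸ 2) (N G u ∩ N G v)) ×
    (∀ m (F : Graph m) → CliqueFree F r → m <2^ exponent r 3≤r ε 0<ε →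
    ¬ (∃ λ (φ : Fin n → Fin m) → IsHomomorphism G F φ))
theorem1p7 (suc (suc (suc k))) (s≤s (s≤s (s≤s z≤n))) ε 0<ε =
  construction k {ε} {8 * (3 + k) ^ (3 + k)} {{8nⁿ-nonZero (3 + k)}}
    (·-pos (8 * (3 + k) ^ (3 + k)) {{8nⁿ-nonZero (3 + k)}} {ε} 0<ε)
    (threshold {ε} 0<ε (8 * suc k ^ suc k) (8 * (3 + k) ^ (3 + k))
      {{8nⁿ-nonZero (suc k)}} {{8nⁿ-nonZero (3 + k)}} (threshold-gap k))
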